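{- For every integer $n\ge 4$, $\sigma_{od}\mathrm{moex}(n+1)>\sigma_{od}\mathrm{moex}(n)$.
   Context: For $n\ge 0$, $\mathcal{P}_{od}(n)$ is the set of all partitions of $n$ in which no odd part is repeated (even parts may appear with any multiplicity). For $\lambda\in\mathcal{P}_{od}(n)$, $\mathrm{moex}(\lambda)$ is the smallest positive odd integer that is not a part of $\lambda$. Define $\sigma_{od}\mathrm{moex}(n):=\sum_{\lambda\in\mathcal{P}_{od}(n)}\mathrm{moex}(\lambda)$. -}

module Defs where

open import Data.List using (List; []; _∷_; map; length; filter; concatMap; applyUpTo)
open import Data.List.Membership.Propositional using (_∈_; _∉_; lose)
open import Data.List.Membership.Propositional.Properties using (∈-map⁺; ∈-map⁻; ∈-concatMap⁺; ∈-filter⁺; ∈-filter⁻; ∈-applyUpTo⁺)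
open import Data.List.Membership.DecPropositional using (_∈?_)
open import Data.List.Properties using (∷-injective; ∷-injectiveʳ)
open import Data.List.Relation.Binary.Disjoint.Propositional using (Disjoint)
open import Data.List.Relation.Unary.All as All using (All; []; _∷_)
import Data.List.Relation.Unary.All.Properties as All
import Data.List.Relation.Unary.AllPairs as AllPairs
import Data.List.Relation.Unary.AllPairs.Properties as AllPairs
open import Data.List.Relation.Unary.Any using (here; there)
open import Data.List.Relation.Unary.Linked using (Linked; []; [-]; _∷_; linked?)
open import Data.List.Relation.Unary.Unique.Propositional using (Unique)
import Data.List.Relation.Unary.Unique.Propositional.Properties as Unique
open import Data.Nat using (ℕ; zero; suc; _+_; _*_; _∸_; _%_; _⊓_; _≤_; _<_; _≥_; z≤n; s≤s; _≟_; _≤?_; _<?_; _≥?_)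
open import Data.Nat.DivMod using (%-distribˡ-+)
open import Data.Nat.ListAction using (sum)
open import Data.Nat.Properties
open import Data.Product using (_×_; _,_; proj₁; proj₂)
open import Function using (_∘_)
open import Function.Bundles using (_⇔_; mk⇔)
open import Relation.Binary.PropositionalEquality using (_≡_; _≢_; refl; sym; trans; cong; subst)
open import Relation.Nullary using (¬_; Dec; yes; no)
open import Relation.Nullary.Decidable using (_×-dec_; _→-dec_)
open import Relation.Unary using (Decidable)

Odd : ℕ → Set
Odd p = p % 2 ≡ 1

multiplicity : ℕ → List ℕ → ℕ
multiplicity p xs = length (filter (p ≟_) xs)

-- A partition is the weakly decreasing list of its parts.
IsPartition : ℕ → List ℕ → Set
IsPartition n xs = All (0 <_) xs × Linked _≥_ xs × sum xs ≡ n

OddPartsDistinct : List ℕ → Set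
OddPartsDistinct xs = All (λ p → Odd p → multiplicity p xs ≤ 1) xs

_∈𝒫od_ : List ℕ → ℕ → Set
xs ∈𝒫od n = IsPartition n xs × OddPartsDistinct xs

isPartition? : ∀ n → Decidable (IsPartition n)
isPartition? n xs = All.all? (0 <?_) xs ×-dec linked? _≥?_ xs ×-dec sum xs ≟ n

oddPartsDistinct? : Decidable OddPartsDistinct
oddPartsDistinct? xs = All.all? (λ p → (p % 2 ≟ 1) →-dec (multiplicity p xs ≤? 1)) xs

_∈𝒫od?_ : ∀ xs n → Dec (xs ∈𝒫od n)
xs ∈𝒫od? n = isPartition? n xs ×-dec oddPartsDistinct? xs

-- candidates f m n lists the partitions of n into at most f parts, all ≤ m.
candidates : ℕ → ℕ → ℕ → List (List ℕ)
candidates f       m zero      = [] ∷ []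
candidates zero    m (suc n)   = []
candidates (suc f) m n@(suc _) =
  concatMap (λ p → map (p ∷_) (candidates f p (n ∸ p))) (applyUpTo suc (m ⊓ n))

-- A partition of n has at most n parts, each ≤ n, so nothing is missed;
-- see ∈-𝒫od⇔ and 𝒫od-unique.
𝒫od : ℕ → List (List ℕ)
𝒫od n = filter (_∈𝒫od? n) (candidates n n n)

-- Searches k, k + 2, k + 4, …; the first argument bounds the number of steps.
moexFrom : ℕ → ℕ → List ℕ → ℕ
moexFrom zero    k xs = k
moexFrom (suc f) k xs with _∈?_ _≟_ k xs
... | yes _ = moexFrom f (2 + k) xs
... | no  _ = k

-- The bound sum xs suffices, since 1 + 2 * sum xs exceeds every part;
-- see moex-isMoex.
moex : List ℕ → ℕ
moex xs = moexFrom (sum xs) 1 xs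

σodmoex : ℕ → ℕ
σodmoex n = sum (map moex (𝒫od n))

IsMoex : List ℕ → ℕ → Set
IsMoex xs m = (Odd m × m ∉ xs) × (∀ k → Odd k → k ∉ xs → m ≤ k)

private

  ∈⇒≤sum : ∀ {x xs} → x ∈ xs → x ≤ sum xs
  ∈⇒≤sum {xs = y ∷ ys} (here refl) = m≤m+n y (sum ys)
  ∈⇒≤sum {xs = y ∷ ys} (there i)   = ≤-trans (∈⇒≤sum i) (m≤n+m (sum ys) y)

  odd-2+ : ∀ k → Odd k → Odd (2 + k)
  odd-2+ k o = trans (%-distribˡ-+ 2 k 2) (trans (cong (_% 2) o) refl)

  ¬odd-suc : ∀ k → Odd k → ¬ Odd (suc k)
  ¬odd-suc k o o′ with trans (sym o′) (trans (%-distribˡ-+ 1 k 2) (cong (λ r → suc r % 2) o))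
  ... | ()

  moexFrom-isMoex : ∀ f k xs → Odd k → sum xs < k + 2 * f →
    (∀ j → Odd j → j ∉ xs → k ≤ j) → IsMoex xs (moexFrom f k xs)
  moexFrom-isMoex zero k xs o b low =
    (o , λ i → <⇒≱ (subst (sum xs <_) (+-identityʳ k) b) (∈⇒≤sum i)) , low
  moexFrom-isMoex (suc f) k xs o b low with _∈?_ _≟_ k xs
  ... | no k∉  = (o , k∉) , low
  ... | yes k∈ = moexFrom-isMoex f (2 + k) xs (odd-2+ k o) (subst (sum xs <_) eq b) low′
    where
    eq : k + 2 * suc f ≡ 2 + k + 2 * f
    eq = trans (cong (k +_) (*-suc 2 f))
        (trans (sym (+-assoc k 2 (2 * f))) (cong (_+ 2 * f) (+-comm k 2)))
    low′ : ∀ j → Odd j → j ∉ xs → 2 + k ≤ j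
    low′ j oj j∉ = ≤∧≢⇒< (≤∧≢⇒< (low j oj j∉) (λ { refl → j∉ k∈ }))
                          (λ { refl → ¬odd-suc k o oj })

  candidates-complete : ∀ f m n xs → length xs ≤ f → All (_≤ m) xs →
    IsPartition n xs → xs ∈ candidates f m n
  candidates-complete f m zero [] l b _ = here refl
  candidates-complete f m zero (suc x ∷ xs) l b (_ , _ , ())
  candidates-complete f m zero (zero ∷ xs) l b (() ∷ _ , _)
  candidates-complete f m (suc n) [] l b (_ , _ , ())
  candidates-complete (suc f) m (suc n) (zero ∷ xs) l b (() ∷ _ , _)
  candidates-complete (suc f) m (suc n) (suc x ∷ xs) (s≤s l) (x≤m ∷ _) (_ ∷ pos , lk , eq) =
    ∈-concatMap⁺ _ (lose (∈-applyUpTo⁺ suc (⊓-glb x≤m x≤n))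
      (∈-map⁺ (suc x ∷_) (candidates-complete f (suc x) (n ∸ x) xs l (bounded lk) (pos , tail lk , eq′))))
    where
    x≤n : suc x ≤ suc n
    x≤n = subst (suc x ≤_) eq (m≤m+n (suc x) (sum xs))
    eq′ : sum xs ≡ n ∸ x
    eq′ = trans (sym (m+n∸m≡n (suc x) (sum xs))) (cong (_∸ suc x) eq)
    tail : ∀ {y ys} → Linked _≥_ (y ∷ ys) → Linked _≥_ ys
    tail [-]     = []
    tail (_ ∷ r) = r
    bounded : ∀ {y ys} → Linked _≥_ (y ∷ ys) → All (_≤ y) ys
    bounded [-]       = []
    bounded (y≥z ∷ r) = y≥z ∷ All.map (λ w≤z → ≤-trans w≤z y≥z) (bounded r)

  candidates-unique : ∀ f m n → Unique (candidates f m n)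
  candidates-unique zero    m zero    = [] AllPairs.∷ AllPairs.[]
  candidates-unique (suc f) m zero    = [] AllPairs.∷ AllPairs.[]
  candidates-unique zero    m (suc n) = AllPairs.[]
  candidates-unique (suc f) m (suc n) = Unique.concat⁺
    (All.map⁺ (All.tabulate λ {p} _ → Unique.map⁺ ∷-injectiveʳ (candidates-unique f p (suc n ∸ p))))
    (AllPairs.map⁺ (AllPairs.map disjoint
      (Unique.applyUpTo⁺₁ suc (m ⊓ suc n) (λ i<j _ eq → <⇒≢ i<j (suc-injective eq)))))
    where
    disjoint : ∀ {p q xss yss} → p ≢ q → Disjoint (map (p ∷_) xss) (map (q ∷_) yss)
    disjoint p≢q (i , j) with ∈-map⁻ _ i | ∈-map⁻ _ j
    ... | _ , _ , eq | _ , _ , eq′ = p≢q (proj₁ (∷-injective (trans (sym eq) eq′)))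

  length≤sum : ∀ {xs} → All (0 <_) xs → length xs ≤ sum xs
  length≤sum []          = z≤n
  length≤sum (0<x ∷ pos) = +-mono-≤ 0<x (length≤sum pos)

moex-isMoex : ∀ xs → IsMoex xs (moex xs)
moex-isMoex xs = moexFrom-isMoex (sum xs) 1 xs refl (s≤s (m≤m+n (sum xs) _)) low
  where
  low : ∀ j → Odd j → j ∉ xs → 1 ≤ j
  low (suc j) _ _ = s≤s z≤n

∈-𝒫od⇔ : ∀ n xs → xs ∈ 𝒫od n ⇔ xs ∈𝒫od n
∈-𝒫od⇔ n xs = mk⇔ (proj₂ ∘ ∈-filter⁻ (_∈𝒫od? n) {xs = candidates n n n}) complete
  where
  complete : xs ∈𝒫od n → xs ∈ 𝒫od n
  complete h@(part@(pos , _ , refl) , _) = ∈-filter⁺ (_∈𝒫od? n)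
    (candidates-complete n n n xs (length≤sum pos) (All.tabulate ∈⇒≤sum) part) h

𝒫od-unique : ∀ n → Unique (𝒫od n)
𝒫od-unique n = Unique.filter⁺ (_∈𝒫od? n) (candidates-unique n n n)

{-# OPTIONS --safe #-}
module Submission where

-- Let A_L be the generating function of the sum of moex over the partitions with distinct odd
-- parts and all parts at most 2L, and F_L = q^(L²) / ((1-q²)⋯(1-q^(2L))) that of the number of
-- those with moex 2L+1. Deciding on the parts a = 2L+1 and b = 2L+2 gives
--   (1 - q^b) A_{L+1} = (1 + q^a) A_L + 2 q^a F_L.
-- It follows that (1-q) A_L = X_L + 2 F_{L-1} + 2 (1-q) F_L with X_0 = -(1-q), F_{-1} = 0 and
--   (1 - q^b) X_{L+1} = (1 + q^a) X_L + 2 (1 - q^(2L) + q^a) F_{L-1};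
-- this rests on (1-q)(1+q^a) = (1-q^b) - q (1-q^(2L)) and (1-q^(2L)) F_L = q^(2L-1) F_{L-1}.
-- For L ≥ 2 the F-term is nonnegative, since F_{L-1} has a factor 1/(1-q²). The
-- coefficients of (1-q⁸) X_4 are quasi-linear and can be checked directly; from then on the
-- recurrence keeps every coefficient of X_L beyond q⁴ positive. As F_L = O(q^L), letting L
-- exceed n yields the theorem.

open import Defs
open import Data.Bool using (if_then_else_)
open import Data.Empty using (⊥-elim)
open import Data.Integer as ℤ using (ℤ; +_; -[1+_]; 0ℤ; 1ℤ)
import Data.Integer.Properties as ℤ
open import Data.Integer.Tactic.RingSolver using (solve-∀)
open import Data.List using (List; []; _∷_; _++_; map; length)
open import Data.List.Membership.Propositional using (_∈_; _∉_)
open import Data.List.Membership.Propositional.Properties using (∈-++⁺ˡ; ∈-++⁺ʳ; ∈-map⁺; ∈-map⁻)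
open import Data.List.Membership.Propositional.Properties.WithK using (unique∧set⇒bag)
open import Data.List.Properties using (map-++; map-∘; map-cong-local; filter-accept; filter-reject; ∷-injectiveʳ)
open import Data.List.Relation.Binary.BagAndSetEquality using (∼bag⇒↭)
open import Data.List.Relation.Binary.Disjoint.Propositional using (Disjoint)
import Data.List.Relation.Binary.Permutation.Propositional.Properties as Permutation
open import Data.List.Relation.Unary.All as All using (All; []; _∷_)
import Data.List.Relation.Unary.All.Properties as All
import Data.List.Relation.Unary.AllPairs as AllPairs
open import Data.List.Relation.Unary.Any using (here; there)
open import Data.List.Relation.Unary.Linked using (Linked; []; [-]; _∷_)
open import Data.List.Relation.Unary.Linked.Properties using (Linked⇒AllPairs)
open import Data.List.Relation.Unary.Unique.Propositional using (Unique)
import Data.List.Relation.Unary.Unique.Propositional.Properties as Unique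
open import Data.Nat using (ℕ; zero; suc; _+_; _*_; _≤_; _<_; _≥_; _>_; z≤n; s≤s; _≟_)
open import Data.Nat.Induction using (<-rec)
open import Data.Nat.ListAction using (sum)
open import Data.Nat.ListAction.Properties using (sum-++; sum-↭)
import Data.Nat.Properties as ℕ
open import Data.Product using (_,_; proj₁; proj₂)
open import Function using (_∘_)
open import Function.Bundles using (mk⇔; Equivalence)
open import Relation.Binary.PropositionalEquality using (_≡_; _≢_; refl; sym; trans; cong; cong₂; subst; subst₂; module ≡-Reasoning)
open import Relation.Nullary using (¬_; yes; no; does)
open import Relation.Nullary.Decidable using (dec-true; dec-false; from-yes)

double : ℕ → ℕ
double zero    = zero
double (suc n) = suc (suc (double n))

-- Delayed sequences and recurrences with a lag

-- Recursion on both `k` and the index, instead of subtraction, makes `lag k f z (k + n)` reduce to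
-- `f n` for literal `k`; the periodicity proofs below compute this way.
lag : {A : Set} → ℕ → (ℕ → A) → A → ℕ → A
lag zero    f z n       = f n
lag (suc k) f z zero    = z
lag (suc k) f z (suc n) = lag k f z n

lag-+ : {A : Set} (k : ℕ) (f : ℕ → A) (z : A) (n : ℕ) → lag k f z (k + n) ≡ f n
lag-+ zero    f z n = refl
lag-+ (suc k) f z n = lag-+ k f z n

lag-< : {A : Set} (k : ℕ) (f : ℕ → A) (z : A) (n : ℕ) → n < k → lag k f z n ≡ z
lag-< (suc k) f z zero    _         = refl
lag-< (suc k) f z (suc n) (s≤s n<k) = lag-< k f z n n<k

lag-cong : {A : Set} (k : ℕ) {f g : ℕ → A} {z : A} (n : ℕ) →
  (∀ m → m ≤ n → f m ≡ g m) → lag k f z n ≡ lag k g z n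
lag-cong zero    n       eq = eq n ℕ.≤-refl
lag-cong (suc k) zero    eq = refl
lag-cong (suc k) (suc n) eq = lag-cong k n λ m m≤n → eq m (ℕ.m≤n⇒m≤1+n m≤n)

lag-cong-< : {A : Set} (k : ℕ) {f g : ℕ → A} {z : A} (n : ℕ) →
  (∀ m → m < n → f m ≡ g m) → lag (suc k) f z n ≡ lag (suc k) g z n
lag-cong-< k zero    eq = refl
lag-cong-< k (suc n) eq = lag-cong k n λ m m≤n → eq m (s≤s m≤n)

lag-elim : {A : Set} (P : A → Set) (k : ℕ) {f : ℕ → A} {z : A} (n : ℕ) →
  P z → (∀ {m} → m ≤ n → P (f m)) → P (lag k f z n)
lag-elim P zero    n       Pz Pf = Pf ℕ.≤-refl
lag-elim P (suc k) zero    Pz Pf = Pz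
lag-elim P (suc k) (suc n) Pz Pf = lag-elim P k n Pz λ m≤n → Pf (ℕ.m≤n⇒m≤1+n m≤n)

lag-elim-< : {A : Set} (P : A → Set) (k : ℕ) {f : ℕ → A} {z : A} (n : ℕ) →
  P z → (∀ {m} → m < n → P (f m)) → P (lag (suc k) f z n)
lag-elim-< P k zero    Pz Pf = Pz
lag-elim-< P k (suc n) Pz Pf = lag-elim P k n Pz λ m≤n → Pf (s≤s m≤n)

lag-natural : {A B : Set} (h : A → B) (k : ℕ) (f : ℕ → A) (z : A) (n : ℕ) →
  h (lag k f z n) ≡ lag k (h ∘ f) (h z) n
lag-natural h zero    f z n       = refl
lag-natural h (suc k) f z zero    = refl
lag-natural h (suc k) f z (suc n) = lag-natural h k f z n

data Split (M : ℕ) : ℕ → Set where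
  below  : ∀ {n} → n < M → Split M n
  beyond : ∀ j → Split M (M + j)

split : ∀ M n → Split M n
split zero    n       = beyond n
split (suc M) zero    = below (s≤s z≤n)
split (suc M) (suc n) with split M n
... | below n<M  = below (s≤s n<M)
... | beyond j   = beyond j

module _ {A : Set} (b : ℕ) (step : ℕ → A → A) (z : A) where

  -- The value at `n` refers to index `n - (1 + b)`, which is not structurally smaller, so fuel
  -- drives the recursion. Each step lowers the index, so fuel `n + 1` is enough.
  fuelled : ℕ → ℕ → A
  fuelled zero    n = z
  fuelled (suc t) n = step n (lag (suc b) (fuelled t) z n)

  recurrence : ℕ → A
  recurrence n = fuelled (suc n) n

  fuelled-stable : ∀ t u n → n < t → n < u → fuelled t n ≡ fuelled u n
  fuelled-stable (suc t) (suc u) n (s≤s n≤t) (s≤s n≤u) =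
    cong (step n) (lag-cong-< b n λ m m<n →
      fuelled-stable t u m (ℕ.<-≤-trans m<n n≤t) (ℕ.<-≤-trans m<n n≤u))

  recurrence-eq : ∀ n → recurrence n ≡ step n (lag (suc b) recurrence z n)
  recurrence-eq n = cong (step n) (lag-cong-< b n λ m m<n →
    fuelled-stable n (suc m) m m<n ℕ.≤-refl)

-- Integer power series

Series : Set
Series = ℕ → ℤ

δ : Series
δ zero    = 1ℤ
δ (suc _) = 0ℤ

-- shift k f is q^k f, and geometric b f is f / (1 - q^(1+b)).
shift : ℕ → Series → Series
shift k f = lag k f 0ℤ

geometric : ℕ → Series → Series
geometric b f = recurrence b (λ n x → f n ℤ.+ x) 0ℤ

geometric-eq : ∀ b f n → geometric b f n ≡ f n ℤ.+ shift (suc b) (geometric b f) n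
geometric-eq b f = recurrence-eq b (λ n x → f n ℤ.+ x) 0ℤ

-- Coefficients of `q^(1+b) g` involve only earlier coefficients of `g`, so the equation determines
-- `g`. Two series are identified below by giving them the same numerator.
geometric-unique : ∀ b (f : Series) {g h : Series} →
  (∀ n → g n ≡ f n ℤ.+ shift (suc b) g n) →
  (∀ n → h n ≡ f n ℤ.+ shift (suc b) h n) → ∀ n → g n ≡ h n
geometric-unique b f {g} {h} eg eh = <-rec (λ n → g n ≡ h n) λ n ih →
  trans (eg n) (trans (cong (λ x → f n ℤ.+ x) (lag-cong-< b n λ m m<n → ih {m} m<n)) (sym (eh n)))

shift-+ : ∀ k (f g : Series) n → shift k (λ m → f m ℤ.+ g m) n ≡ shift k f n ℤ.+ shift k g n
shift-+ zero    f g n       = refl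
shift-+ (suc k) f g zero    = refl
shift-+ (suc k) f g (suc n) = shift-+ k f g n

shift-- : ∀ k (f g : Series) n → shift k (λ m → f m ℤ.- g m) n ≡ shift k f n ℤ.- shift k g n
shift-- zero    f g n       = refl
shift-- (suc k) f g zero    = refl
shift-- (suc k) f g (suc n) = shift-- k f g n

shift-* : ∀ k c (f : Series) n → shift k (λ m → c ℤ.* f m) n ≡ c ℤ.* shift k f n
shift-* k c f n = trans (cong (λ z → lag k (λ m → c ℤ.* f m) z n) (sym (ℤ.*-zeroʳ c)))
                        (sym (lag-natural (c ℤ.*_) k f 0ℤ n))

shift-shift : ∀ j k f n → shift j (shift k f) n ≡ shift (j + k) f n
shift-shift zero    k f n       = refl
shift-shift (suc j) k f zero    = refl
shift-shift (suc j) k f (suc n) = shift-shift j k f n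

shift-comm : ∀ j k f n → shift j (shift k f) n ≡ shift k (shift j f) n
shift-comm j k f n = trans (shift-shift j k f n)
  (trans (cong (λ i → shift i f n) (ℕ.+-comm j k)) (sym (shift-shift k j f n)))

shift-cong : ∀ k {f g : Series} → (∀ n → f n ≡ g n) → ∀ n → shift k f n ≡ shift k g n
shift-cong k eq n = lag-cong k n λ m _ → eq m

NonNegative : Series → Set
NonNegative f = ∀ n → 0ℤ ℤ.≤ f n

shift-nonNegative : ∀ k {f} → NonNegative f → NonNegative (shift k f)
shift-nonNegative k f≥0 n = lag-elim (0ℤ ℤ.≤_) k n ℤ.≤-refl λ {m} _ → f≥0 m

geometric-nonNegative : ∀ b {f} → NonNegative f → NonNegative (geometric b f)
geometric-nonNegative b {f} f≥0 = <-rec _ λ n ih →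
  subst (0ℤ ℤ.≤_) (sym (geometric-eq b f n)) (ℤ.+-mono-≤ (f≥0 n) (lag-elim-< (0ℤ ℤ.≤_) b n ℤ.≤-refl ih))

-- Series that stay nonnegative after multiplication by `1 - q²`

Increasing₂ : Series → Set
Increasing₂ f = ∀ n → f n ℤ.≤ f (2 + n)

shift-increasing₂ : ∀ k {f} → NonNegative f → Increasing₂ f → Increasing₂ (shift k f)
shift-increasing₂ zero    f≥0 inc n       = inc n
shift-increasing₂ (suc k) f≥0 inc zero    = shift-nonNegative (suc k) f≥0 2
shift-increasing₂ (suc k) f≥0 inc (suc n) = shift-increasing₂ k f≥0 inc n

shift-increasing₂-< : ∀ k {f} → NonNegative f → ∀ n → (∀ {m} → m < n → f m ℤ.≤ f (2 + m)) →
  shift (suc k) f n ℤ.≤ shift (suc k) f (2 + n)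
shift-increasing₂-< k       f≥0 zero    inc = shift-nonNegative (suc k) f≥0 2
shift-increasing₂-< zero    f≥0 (suc n) inc = inc ℕ.≤-refl
shift-increasing₂-< (suc k) f≥0 (suc n) inc = shift-increasing₂-< k f≥0 n λ m<n → inc (ℕ.m≤n⇒m≤1+n m<n)

geometric-increasing₂ : ∀ b {f} → NonNegative f → Increasing₂ f → Increasing₂ (geometric b f)
geometric-increasing₂ b {f} f≥0 inc = <-rec _ λ n ih →
  subst₂ ℤ._≤_ (sym (geometric-eq b f n)) (sym (geometric-eq b f (2 + n)))
    (ℤ.+-mono-≤ (inc n) (shift-increasing₂-< b (geometric-nonNegative b f≥0) n ih))

-- Telescoping: `1 - q^(2k)` is `1 - q²` times `1 + q² + ⋯ + q^(2k-2)`. This makes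
-- `(1 - q^(2L)) F_{L-1}` nonnegative in the numerator of `X_{L+1}`.
shift-double-≤ : ∀ k {f} → NonNegative f → Increasing₂ f → ∀ n → shift (double k) f n ℤ.≤ f n
shift-double-≤ zero    f≥0 inc n             = ℤ.≤-refl
shift-double-≤ (suc k) f≥0 inc zero          = f≥0 0
shift-double-≤ (suc k) f≥0 inc (suc zero)    = f≥0 1
shift-double-≤ (suc k) f≥0 inc (suc (suc n)) = ℤ.≤-trans (shift-double-≤ k f≥0 inc n) (inc n)

-- F_L and F_{L-1}.
full : ℕ → Series
full zero    = δ
full (suc L) = geometric (suc (double L)) (shift (suc (double L)) (full L))

fullPred : ℕ → Series
fullPred zero    = λ _ → 0ℤ
fullPred (suc L) = full L

δ-nonNegative : NonNegative δ
δ-nonNegative zero    = ℤ.+≤+ z≤n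
δ-nonNegative (suc n) = ℤ.≤-refl

full-nonNegative : ∀ L → NonNegative (full L)
full-nonNegative zero    = δ-nonNegative
full-nonNegative (suc L) = geometric-nonNegative _ (shift-nonNegative (suc (double L)) (full-nonNegative L))

full-1-period : ∀ n → full 1 (2 + n) ≡ full 1 n
full-1-period n = trans (geometric-eq 1 (shift 1 δ) (2 + n)) (ℤ.+-identityˡ _)

-- `F_1 = q / (1 - q²)` is the equality case, and later factors preserve the property. It fails for
-- `F_0 = 1`, hence the index `suc L`.
full-increasing₂ : ∀ L → Increasing₂ (full (suc L))
full-increasing₂ zero    n = ℤ.≤-reflexive (sym (full-1-period n))
full-increasing₂ (suc L) = geometric-increasing₂ _ (shift-nonNegative k (full-nonNegative (suc L)))
  (shift-increasing₂ k (full-nonNegative (suc L)) (full-increasing₂ L))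
  where k = suc (double (suc L))

n≤double : ∀ n → n ≤ double n
n≤double zero    = z≤n
n≤double (suc n) = s≤s (ℕ.m≤n⇒m≤1+n (n≤double n))

geometric-zero-below : ∀ b {f} N → (∀ n → n < N → f n ≡ 0ℤ) → ∀ n → n < N → geometric b f n ≡ 0ℤ
geometric-zero-below b {f} N f≡0 = <-rec _ λ n ih n<N →
  trans (geometric-eq b f n) (cong₂ ℤ._+_ (f≡0 n n<N)
    (lag-elim-< (_≡ 0ℤ) b n refl λ m<n → ih m<n (ℕ.<-trans m<n n<N)))

-- The last factor `q^(2L-1)` of the numerator already gives order at least `L`.
full-zero-below : ∀ L n → n < L → full L n ≡ 0ℤ
full-zero-below (suc L) = geometric-zero-below _ (suc L) λ n n<L →
  lag-< (suc (double L)) (full L) 0ℤ n (ℕ.<-≤-trans n<L (s≤s (n≤double L)))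

-- excess L is X_L, and excessNumerator L X_L is (1 - q^(2L+2)) X_{L+1}.
excessNumerator : ℕ → Series → Series
excessNumerator L f n =
  (f n ℤ.+ shift a f n) ℤ.+ + 2 ℤ.* ((fullPred L n ℤ.- shift (double L) (fullPred L) n) ℤ.+ shift a (fullPred L) n)
  where a = suc (double L)

excess : ℕ → Series
excess zero    n = shift 1 δ n ℤ.- δ n
excess (suc L) = geometric (suc (double L)) (excessNumerator L (excess L))

-- Lower bounds for the excess

-- For L ≥ 4 the coefficients of X_L begin 1, 2, -2, 3, 3, 1.
floor : ℕ → ℤ
floor 2                               = -[1+ 1 ]
floor (suc (suc (suc (suc (suc _))))) = 1ℤ
floor _                               = 0ℤ

floor≤1 : ∀ n → floor n ℤ.≤ 1ℤ
floor≤1 0 = ℤ.+≤+ z≤n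
floor≤1 1 = ℤ.+≤+ z≤n
floor≤1 2 = ℤ.-≤+
floor≤1 3 = ℤ.+≤+ z≤n
floor≤1 4 = ℤ.+≤+ z≤n
floor≤1 (suc (suc (suc (suc (suc _))))) = ℤ.≤-refl

floor≥0 : ∀ n → 0ℤ ℤ.≤ floor (3 + n)
floor≥0 0             = ℤ.≤-refl
floor≥0 1             = ℤ.≤-refl
floor≥0 (suc (suc n)) = ℤ.+≤+ z≤n

-- Multiplication by 1 + q^M or 1 / (1 - q^M) can lower only the coefficient of q^(M+2),
-- by 2; the bound 3 beyond M + 2 pays for this.
record Bounded (M : ℕ) (f : Series) : Set where
  field
    above-floor : ∀ n → floor n ℤ.≤ f n
    above-three : ∀ n → + 3 ℤ.≤ f (M + (2 + n))

open Bounded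

module _ {M : ℕ} {f g : Series} (0<M : 0 < M) (bf : Bounded M f) where

  private
    h : Series
    h n = f n ℤ.+ shift M g n

    h-beyond : ∀ j → f (M + j) ℤ.+ g j ≡ h (M + j)
    h-beyond j = cong (λ x → f (M + j) ℤ.+ x) (sym (lag-+ M g 0ℤ j))

  -- For `g = f` the series `h = f + q^M g` is `(1 + q^M) f`; for `g = f / (1 - q^M)` it is `g`
  -- itself. The premise concerns only indices below `n`, to serve as induction hypothesis in the
  -- second case.
  lower-floor : ∀ n → (∀ {m} → m < n → floor m ℤ.≤ g m) → floor n ℤ.≤ h n
  lower-floor n ih with split M n
  ... | below n<M = subst (floor n ℤ.≤_)
          (sym (trans (cong (λ x → f n ℤ.+ x) (lag-< M g 0ℤ n n<M)) (ℤ.+-identityʳ (f n)))) (above-floor bf n)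
  ... | beyond j = subst (floor (M + j) ℤ.≤_) (h-beyond j) (bound j (ih (ℕ.m<n+m j 0<M)))
    where
    keep : ∀ {x} i → floor i ℤ.≤ f i → 0ℤ ℤ.≤ x → floor i ℤ.≤ f i ℤ.+ x
    keep {x} i p q = subst (ℤ._≤ f i ℤ.+ x) (ℤ.+-identityʳ (floor i)) (ℤ.+-mono-≤ p q)
    bound : ∀ j → floor j ℤ.≤ g j → floor (M + j) ℤ.≤ f (M + j) ℤ.+ g j
    bound 0 p = keep (M + 0) (above-floor bf _) p
    bound 1 p = keep (M + 1) (above-floor bf _) p
    -- The only case where `g j` may be negative: `floor 2 = -2`, and `3 - 2 = 1` bounds every value
    -- of `floor`.
    bound 2 p = ℤ.≤-trans (floor≤1 (M + 2)) (ℤ.+-mono-≤ (above-three bf 0) p)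
    bound (suc (suc (suc j))) p = keep _ (above-floor bf _) (ℤ.≤-trans (floor≥0 j) p)

  -- From `M + 3` on, the coefficient of `g` that is added has index at least 3, where `floor` is
  -- nonnegative. The threshold thus moves up by one with each factor.
  lower-three : (∀ n → floor n ℤ.≤ g n) → ∀ n → + 3 ℤ.≤ h (suc M + (2 + n))
  lower-three fg n = subst (λ i → + 3 ℤ.≤ h i) (ℕ.+-suc M (2 + n))
    (subst (+ 3 ℤ.≤_) (h-beyond (3 + n))
      (ℤ.+-mono-≤ (above-three bf (suc n)) (ℤ.≤-trans (floor≥0 n) (fg (3 + n)))))

bounded-1+ : ∀ {M f} → 0 < M → Bounded M f → Bounded (suc M) (λ n → f n ℤ.+ shift M f n)
bounded-1+ {f = f} 0<M bf = record
  { above-floor = λ n → lower-floor 0<M bf n λ {m} _ → above-floor bf m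
  ; above-three = lower-three 0<M bf (above-floor bf) }

bounded-geometric : ∀ {b f} → Bounded (suc b) f → Bounded (suc (suc b)) (geometric b f)
bounded-geometric {b} {f} bf = record { above-floor = floor≤ ; above-three = three≤ }
  where
  floor≤ : ∀ n → floor n ℤ.≤ geometric b f n
  floor≤ = <-rec _ λ n ih →
    subst (floor n ℤ.≤_) (sym (geometric-eq b f n)) (lower-floor {g = geometric b f} (s≤s z≤n) bf n ih)
  three≤ : ∀ n → + 3 ℤ.≤ geometric b f (suc (suc b) + (2 + n))
  three≤ n = subst (+ 3 ℤ.≤_) (sym (geometric-eq b f (suc (suc b) + (2 + n))))
    (lower-three {g = geometric b f} (s≤s z≤n) bf floor≤ n)

bounded-+ : ∀ {M f g} → Bounded M f → NonNegative g → Bounded M (λ n → f n ℤ.+ g n)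
bounded-+ {M} {f} {g} bf g≥0 = record
  { above-floor = λ n → add n (above-floor bf n)
  ; above-three = λ n → add (M + (2 + n)) (above-three bf n) }
  where
  add : ∀ {x} n → x ℤ.≤ f n → x ℤ.≤ f n ℤ.+ g n
  add {x} n p = subst (ℤ._≤ f n ℤ.+ g n) (ℤ.+-identityʳ x) (ℤ.+-mono-≤ p (g≥0 n))

-- The initial series `X_1` to `X_4`

-- `(1 - q²) X_1 = (1 + q)(q - 1)`, so `X_1 = -1`.
excess-1-zero : ∀ n → excess 1 (suc n) ≡ 0ℤ
excess-1-zero 0             = refl
excess-1-zero 1             = refl
excess-1-zero (suc (suc n)) =
  trans (geometric-eq 1 (excessNumerator 0 (excess 0)) (3 + n)) (trans (ℤ.+-identityˡ _) (excess-1-zero n))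

-- `(1 - q⁴) X_2 = 1 - 2q² + q³` has degree below 4, so the coefficients repeat 1, 0, -2, 1.
excess-2-period : ∀ n → excess 2 (4 + n) ≡ excess 2 n
excess-2-period n = trans (geometric-eq 3 (excessNumerator 1 (excess 1)) (4 + n))
  (trans (cong (ℤ._+ excess 2 n) eq) (ℤ.+-identityˡ _))
  where
  eq : excessNumerator 1 (excess 1) (4 + n) ≡ 0ℤ
  eq rewrite excess-1-zero (3 + n) | excess-1-zero n = refl

-- `(1 - q⁶) X_3 = (1 + q⁵) X_2 + 2 (q + q³) + 2 q⁵
-- F_1`, where `X_2` has period 4 and `F_1` period 2. From `q⁵` on the coefficients repeat 1, 0, -1,
-- 4.
numerator-2-period : ∀ n → excessNumerator 2 (excess 2) (9 + n) ≡ excessNumerator 2 (excess 2) (5 + n)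
numerator-2-period n
  rewrite excess-2-period (5 + n) | excess-2-period n
        | full-1-period (7 + n) | full-1-period (5 + n) | full-1-period (3 + n)
        | full-1-period (2 + n) | full-1-period (1 + n) | full-1-period n = refl

numerator-2-pairs : ∀ n → 0ℤ ℤ.≤ excessNumerator 2 (excess 2) (7 + n) ℤ.+ excessNumerator 2 (excess 2) (5 + n)
numerator-2-pairs 0 = ℤ.+≤+ z≤n
numerator-2-pairs 1 = ℤ.+≤+ z≤n
numerator-2-pairs 2 = ℤ.+≤+ z≤n
numerator-2-pairs 3 = ℤ.+≤+ z≤n
numerator-2-pairs (suc (suc (suc (suc n)))) = subst (0ℤ ℤ.≤_)
  (sym (cong₂ ℤ._+_ (numerator-2-period (2 + n)) (numerator-2-period n))) (numerator-2-pairs n)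

-- One step of the lag 6 may lower a coefficient, as the numerator takes the value -1. Two steps add
-- its values at `12 + n` and `6 + n`; period 4 moves the first to `8 + n`, which leaves a pair two
-- apart.
excess-3-increasing₁₂ : ∀ n → excess 3 n ℤ.≤ excess 3 (12 + n)
excess-3-increasing₁₂ n = subst₂ ℤ._≤_ (ℤ.+-identityˡ _) (sym eq)
  (ℤ.+-monoˡ-≤ (excess 3 n) (numerator-2-pairs (suc n)))
  where
  s = excessNumerator 2 (excess 2)
  eq : excess 3 (12 + n) ≡ s (8 + n) ℤ.+ s (6 + n) ℤ.+ excess 3 n
  eq = trans (geometric-eq 5 s (12 + n))
      (trans (cong₂ ℤ._+_ (numerator-2-period (3 + n)) (geometric-eq 5 s (6 + n)))
             (sym (ℤ.+-assoc (s (8 + n)) (s (6 + n)) (excess 3 n))))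

-- `(1 - q⁴)(1 - q⁶) F_2 = q⁴ + q⁶ + q⁸` is a polynomial, so `(1 - q⁶) F_2` eventually has period 4.
full-2-difference : ∀ n → full 2 (10 + n) ℤ.- full 2 (4 + n) ≡ full 2 (6 + n) ℤ.- full 2 n
full-2-difference n = begin
  full 2 (10 + n) ℤ.- full 2 (4 + n)
    ≡⟨ cong₂ ℤ._-_ (geometric-eq 3 (shift 3 (full 1)) (10 + n)) (geometric-eq 3 (shift 3 (full 1)) (4 + n)) ⟩
  (full 1 (7 + n) ℤ.+ full 2 (6 + n)) ℤ.- (full 1 (1 + n) ℤ.+ full 2 n)
    ≡⟨ cong (λ x → (x ℤ.+ full 2 (6 + n)) ℤ.- (full 1 (1 + n) ℤ.+ full 2 n)) period ⟩
  (full 1 (1 + n) ℤ.+ full 2 (6 + n)) ℤ.- (full 1 (1 + n) ℤ.+ full 2 n)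
    ≡⟨ cancel (full 1 (1 + n)) (full 2 (6 + n)) (full 2 n) ⟩
  full 2 (6 + n) ℤ.- full 2 n ∎
  where
  open ≡-Reasoning
  period : full 1 (7 + n) ≡ full 1 (1 + n)
  period = trans (full-1-period (5 + n)) (trans (full-1-period (3 + n)) (full-1-period (1 + n)))
  cancel : ∀ x y z → (x ℤ.+ y) ℤ.- (x ℤ.+ z) ≡ y ℤ.- z
  cancel = solve-∀

-- `(1 - q⁸) X_4 = (1 + q⁷) X_3 + 2 (1 - q⁶) F_2 + 2 q⁷ F_2`. Over 12 steps `X_3` does not decrease,
-- the middle term repeats, and `F_2` grows in steps of two.
numerator-3-increasing₁₂ : ∀ n →
  excessNumerator 3 (excess 3) (7 + n) ℤ.≤ excessNumerator 3 (excess 3) (19 + n)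
numerator-3-increasing₁₂ n = ℤ.+-mono-≤
  (ℤ.+-mono-≤ (excess-3-increasing₁₂ (7 + n)) (excess-3-increasing₁₂ n))
  (ℤ.*-monoˡ-≤-nonNeg (+ 2) (ℤ.+-mono-≤ (ℤ.≤-reflexive (sym difference)) increasing))
  where
  difference : full 2 (19 + n) ℤ.- full 2 (13 + n) ≡ full 2 (7 + n) ℤ.- full 2 (1 + n)
  difference = trans (full-2-difference (9 + n))
              (trans (full-2-difference (5 + n)) (full-2-difference (1 + n)))
  inc = full-increasing₂ 1
  increasing : full 2 n ℤ.≤ full 2 (12 + n)
  increasing = ℤ.≤-trans (inc n) (ℤ.≤-trans (inc (2 + n)) (ℤ.≤-trans (inc (4 + n))
    (ℤ.≤-trans (inc (6 + n)) (ℤ.≤-trans (inc (8 + n)) (inc (10 + n))))))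

-- Twelve consecutive values are computed and the increase over 12 steps covers the rest. The start
-- 10 is `M + 2` for `M = 8`.
numerator-3-≥3 : ∀ n → + 3 ℤ.≤ excessNumerator 3 (excess 3) (10 + n)
numerator-3-≥3 0  = from-yes (+ 3 ℤ.≤? excessNumerator 3 (excess 3) 10)
numerator-3-≥3 1  = from-yes (+ 3 ℤ.≤? excessNumerator 3 (excess 3) 11)
numerator-3-≥3 2  = from-yes (+ 3 ℤ.≤? excessNumerator 3 (excess 3) 12)
numerator-3-≥3 3  = from-yes (+ 3 ℤ.≤? excessNumerator 3 (excess 3) 13)
numerator-3-≥3 4  = from-yes (+ 3 ℤ.≤? excessNumerator 3 (excess 3) 14)
numerator-3-≥3 5  = from-yes (+ 3 ℤ.≤? excessNumerator 3 (excess 3) 15)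
numerator-3-≥3 6  = from-yes (+ 3 ℤ.≤? excessNumerator 3 (excess 3) 16)
numerator-3-≥3 7  = from-yes (+ 3 ℤ.≤? excessNumerator 3 (excess 3) 17)
numerator-3-≥3 8  = from-yes (+ 3 ℤ.≤? excessNumerator 3 (excess 3) 18)
numerator-3-≥3 9  = from-yes (+ 3 ℤ.≤? excessNumerator 3 (excess 3) 19)
numerator-3-≥3 10 = from-yes (+ 3 ℤ.≤? excessNumerator 3 (excess 3) 20)
numerator-3-≥3 11 = from-yes (+ 3 ℤ.≤? excessNumerator 3 (excess 3) 21)
numerator-3-≥3 (suc (suc (suc (suc (suc (suc (suc (suc (suc (suc (suc (suc n)))))))))))) =
  ℤ.≤-trans (numerator-3-≥3 n) (numerator-3-increasing₁₂ (3 + n))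

numerator-3-bounded : Bounded 8 (excessNumerator 3 (excess 3))
numerator-3-bounded = record { above-floor = floor≤ ; above-three = numerator-3-≥3 }
  where
  floor≤ : ∀ n → floor n ℤ.≤ excessNumerator 3 (excess 3) n
  floor≤ 0 = from-yes (floor 0 ℤ.≤? excessNumerator 3 (excess 3) 0)
  floor≤ 1 = from-yes (floor 1 ℤ.≤? excessNumerator 3 (excess 3) 1)
  floor≤ 2 = from-yes (floor 2 ℤ.≤? excessNumerator 3 (excess 3) 2)
  floor≤ 3 = from-yes (floor 3 ℤ.≤? excessNumerator 3 (excess 3) 3)
  floor≤ 4 = from-yes (floor 4 ℤ.≤? excessNumerator 3 (excess 3) 4)
  floor≤ 5 = from-yes (floor 5 ℤ.≤? excessNumerator 3 (excess 3) 5)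
  floor≤ 6 = from-yes (floor 6 ℤ.≤? excessNumerator 3 (excess 3) 6)
  floor≤ 7 = from-yes (floor 7 ℤ.≤? excessNumerator 3 (excess 3) 7)
  floor≤ 8 = from-yes (floor 8 ℤ.≤? excessNumerator 3 (excess 3) 8)
  floor≤ 9 = from-yes (floor 9 ℤ.≤? excessNumerator 3 (excess 3) 9)
  floor≤ (suc (suc (suc (suc (suc (suc (suc (suc (suc (suc n)))))))))) =
    ℤ.≤-trans (ℤ.+≤+ (s≤s z≤n)) (numerator-3-≥3 n)

-- The index of `Bounded` is always the exponent of the next factor: multiplying by `1 + q^a` moves
-- it from `a` to `b = a + 1`, and dividing by `1 - q^b` to `b + 1`, the next `a`.
excess-bounded : ∀ L → Bounded (suc (double (4 + L))) (excess (4 + L))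
excess-bounded zero    = bounded-geometric numerator-3-bounded
excess-bounded (suc L) = bounded-geometric
  (bounded-+ (bounded-1+ (s≤s z≤n) (excess-bounded L)) λ n →
    ℤ.*-monoˡ-≤-nonNeg (+ 2) (ℤ.+-mono-≤
      (ℤ.i≤j⇒0≤j-i (shift-double-≤ (4 + L) (full-nonNegative (3 + L)) (full-increasing₂ (2 + L)) n))
      (shift-nonNegative (suc (double (4 + L))) (full-nonNegative (3 + L)) n)))

one≤excess : ∀ L n → 1ℤ ℤ.≤ excess (4 + L) (5 + n)
one≤excess L n = above-floor (excess-bounded L) (5 + n)

-- Partitions with distinct odd parts, by largest part

-- `oddOnce` ranges over all `p`, so it passes directly to tails and extensions; a `p` that is not a
-- part has multiplicity 0.
record Bounded𝒫od (M n : ℕ) (xs : List ℕ) : Set where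
  field
    partition : IsPartition n xs
    oddOnce   : ∀ p → Odd p → multiplicity p xs ≤ 1
    parts≤    : All (_≤ M) xs

open Bounded𝒫od

odd-double : ∀ L → Odd (suc (double L))
odd-double zero    = refl
odd-double (suc L) = odd-double L

¬odd-double : ∀ L → ¬ Odd (double L)
¬odd-double zero    ()
¬odd-double (suc L) o = ¬odd-double L o

¬odd-suc : ∀ k → Odd k → ¬ Odd (suc k)
¬odd-suc (suc zero)    _ ()
¬odd-suc (suc (suc k)) o o′ = ¬odd-suc k o o′

multiplicity-≡ : ∀ p xs → multiplicity p (p ∷ xs) ≡ suc (multiplicity p xs)
multiplicity-≡ p xs = cong length (filter-accept (p ≟_) refl)

multiplicity-≢ : ∀ {p x} xs → p ≢ x → multiplicity p (x ∷ xs) ≡ multiplicity p xs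
multiplicity-≢ {p} xs p≢x = cong length (filter-reject (p ≟_) p≢x)

multiplicity-∉ : ∀ {p} xs → p ∉ xs → multiplicity p xs ≡ 0
multiplicity-∉ []       _  = refl
multiplicity-∉ (x ∷ xs) p∉ =
  trans (multiplicity-≢ xs (p∉ ∘ here)) (multiplicity-∉ xs (p∉ ∘ there))

multiplicity-∷ : ∀ p x xs → multiplicity p xs ≤ multiplicity p (x ∷ xs)
multiplicity-∷ p x xs with p ≟ x
... | yes refl = ℕ.≤-trans (ℕ.n≤1+n _) (ℕ.≤-reflexive (sym (multiplicity-≡ p xs)))
... | no  p≢x  = ℕ.≤-reflexive (sym (multiplicity-≢ xs p≢x))

∈⇒0<multiplicity : ∀ {p xs} → p ∈ xs → 0 < multiplicity p xs
∈⇒0<multiplicity {p} {x ∷ xs} (here refl) = subst (0 <_) (sym (multiplicity-≡ p xs)) (s≤s z≤n)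
∈⇒0<multiplicity {p} {x ∷ xs} (there i)   = ℕ.<-≤-trans (∈⇒0<multiplicity i) (multiplicity-∷ p x xs)

<⇒∉ : ∀ {M p xs} → All (_≤ M) xs → M < p → p ∉ xs
<⇒∉ xs≤M M<p p∈ = ℕ.<⇒≱ M<p (All.lookup xs≤M p∈)

linked-∷ : ∀ {x xs} → All (_≤ x) xs → Linked _≥_ xs → Linked _≥_ (x ∷ xs)
linked-∷ []        []       = [-]
linked-∷ (y≤x ∷ _) l        = y≤x ∷ l

linked-head : ∀ {x xs} → Linked _≥_ (x ∷ xs) → All (_≤ x) xs
linked-head l = AllPairs.head (Linked⇒AllPairs (λ p q → ℕ.≤-trans q p) l)

linked-tail : ∀ {x xs} → Linked _≥_ (x ∷ xs) → Linked _≥_ xs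
linked-tail [-]     = []
linked-tail (_ ∷ l) = l

weaken : ∀ {M N n xs} → M ≤ N → Bounded𝒫od M n xs → Bounded𝒫od N n xs
weaken M≤N v = record
  { partition = partition v ; oddOnce = oddOnce v
  ; parts≤ = All.map (λ x≤M → ℕ.≤-trans x≤M M≤N) (parts≤ v) }

cons : ∀ {x n xs} → 0 < x → (Odd x → x ∉ xs) → Bounded𝒫od x n xs → Bounded𝒫od x (x + n) (x ∷ xs)
cons {x} {xs = xs} 0<x new v = let pos , l , eq = partition v in record
  { partition = 0<x ∷ pos , linked-∷ (parts≤ v) l , cong (λ m → x + m) eq
  ; oddOnce   = once
  ; parts≤    = ℕ.≤-refl ∷ parts≤ v }
  where
  once : ∀ p → Odd p → multiplicity p (x ∷ xs) ≤ 1
  once p o with p ≟ x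
  ... | yes refl = ℕ.≤-reflexive (trans (multiplicity-≡ p xs) (cong suc (multiplicity-∉ xs (new o))))
  ... | no  p≢x  = subst (_≤ 1) (sym (multiplicity-≢ xs p≢x)) (oddOnce v p o)

uncons : ∀ {M n x xs} → Bounded𝒫od M n (x ∷ xs) → Bounded𝒫od x (sum xs) xs
uncons {x = x} {xs} v with partition v
... | (_ ∷ pos) , l , _ = record
  { partition = pos , linked-tail l , refl
  ; oddOnce   = λ p o → ℕ.≤-trans (multiplicity-∷ p x xs) (oddOnce v p o)
  ; parts≤    = linked-head l }

uncons-odd : ∀ {M n x xs} → Odd (suc x) → Bounded𝒫od M n (suc x ∷ xs) → Bounded𝒫od x (sum xs) xs
uncons-odd {x = x} {xs} o v = record
  { partition = partition u ; oddOnce = oddOnce u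
  ; parts≤ = All.tabulate λ {y} y∈ → ℕ.≤-pred (ℕ.≤∧≢⇒< (All.lookup (parts≤ u) y∈) λ { refl → once y∈ }) }
  where
  u = uncons v
  once : suc x ∉ xs
  once i = ℕ.<⇒≱ (s≤s (∈⇒0<multiplicity i))
    (subst (_≤ 1) (multiplicity-≡ (suc x) xs) (oddOnce v (suc x) o))

-- The largest part comes first. After the odd part `2L+1` the tail has parts at most `2L`, hence
-- comes from `f`; after `2L+2`, which may repeat, it comes from `xss`, the list under construction
-- at a smaller index.
extend : ℕ → (ℕ → List (List ℕ)) → ℕ → List (List ℕ) → List (List ℕ)
extend L f n xss = (f n ++ map (suc (double L) ∷_) (lag (suc (double L)) f [] n)) ++ map (double (suc L) ∷_) xss

-- 𝒫od≤ L n lists the partitions in 𝒫od n with all parts at most 2L.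
𝒫od≤ : ℕ → ℕ → List (List ℕ)
𝒫od≤ zero    zero    = [] ∷ []
𝒫od≤ zero    (suc n) = []
𝒫od≤ (suc L) = recurrence (suc (double L)) (extend L (𝒫od≤ L)) []

𝒫od≤-suc : ∀ L n → 𝒫od≤ (suc L) n ≡ extend L (𝒫od≤ L) n (lag (double (suc L)) (𝒫od≤ (suc L)) [] n)
𝒫od≤-suc L = recurrence-eq (suc (double L)) (extend L (𝒫od≤ L)) []

map-lag-All : ∀ {P : ℕ → List ℕ → Set} {Q : ℕ → List ℕ → Set} x {f : ℕ → List (List ℕ)} →
  0 < x → (∀ m {xs} → P m xs → Q (x + m) (x ∷ xs)) → ∀ n → (∀ {m} → m < n → All (P m) (f m)) →
  All (Q n) (map (x ∷_) (lag x f [] n))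
map-lag-All {Q = Q} x {f} 0<x step n Pf with split x n
... | below n<x = subst (All (Q n) ∘ map (x ∷_)) (sym (lag-< x f [] n n<x)) []
... | beyond m  = subst (All (Q n) ∘ map (x ∷_)) (sym (lag-+ x f [] m))
                    (All.map⁺ (All.map (step m) (Pf (ℕ.m<n+m m 0<x))))

𝒫od≤-sound : ∀ L n → All (Bounded𝒫od (double L) n) (𝒫od≤ L n)
𝒫od≤-sound zero    zero    = record { partition = [] , [] , refl ; oddOnce = λ _ _ → z≤n ; parts≤ = [] } ∷ []
𝒫od≤-sound zero    (suc n) = []
𝒫od≤-sound (suc L) = <-rec _ λ n ih → subst (All (Bounded𝒫od (double (suc L)) n)) (sym (𝒫od≤-suc L n))
  (All.++⁺ (All.++⁺ (All.map (weaken (ℕ.m≤n+m _ 2)) (𝒫od≤-sound L n))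
    (map-lag-All {Q = Q} a (s≤s z≤n) odd n λ {m} _ → 𝒫od≤-sound L m))
    (map-lag-All {Q = Q} (suc a) (s≤s z≤n) even n ih))
  where
  a = suc (double L)
  Q = Bounded𝒫od (suc a)
  odd : ∀ m {xs} → Bounded𝒫od (double L) m xs → Bounded𝒫od (suc a) (a + m) (a ∷ xs)
  odd m v = weaken (ℕ.n≤1+n a)
    (cons (s≤s z≤n) (λ _ → <⇒∉ (parts≤ v) ℕ.≤-refl) (weaken (ℕ.n≤1+n (double L)) v))
  even : ∀ m {xs} → Bounded𝒫od (suc a) m xs → Bounded𝒫od (suc a) (suc a + m) (suc a ∷ xs)
  even m v = cons (s≤s z≤n) (⊥-elim ∘ ¬odd-double (suc L)) v

∈-map-lag : ∀ x {f : ℕ → List (List ℕ)} m {xs} → xs ∈ f m → (x ∷ xs) ∈ map (x ∷_) (lag x f [] (x + m))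
∈-map-lag x {f} m {xs} i = ∈-map⁺ (x ∷_) (subst (xs ∈_) (sym (lag-+ x f [] m)) i)

𝒫od≤-complete : ∀ L {n} xs → Bounded𝒫od (double L) n xs → xs ∈ 𝒫od≤ L n
𝒫od≤-complete zero [] v with refl ← proj₂ (proj₂ (partition v)) = here refl
𝒫od≤-complete zero (x ∷ xs) v with proj₁ (partition v) | parts≤ v
... | s≤s z≤n ∷ _ | () ∷ _
𝒫od≤-complete (suc L) {n} xs v = subst (xs ∈_) (sym (𝒫od≤-suc L n)) (go xs v)
  where
  a = suc (double L)
  go : ∀ {n} xs → Bounded𝒫od (suc a) n xs →
    xs ∈ extend L (𝒫od≤ L) n (lag (suc a) (𝒫od≤ (suc L)) [] n)
  go [] v = ∈-++⁺ˡ (∈-++⁺ˡ (𝒫od≤-complete L [] record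
    { partition = partition v ; oddOnce = oddOnce v ; parts≤ = [] }))
  go {n} (x ∷ xs) v with refl ← proj₂ (proj₂ (partition v)) | x≤ ∷ _ ← parts≤ v with x ≟ suc a | x ≟ a
  -- The part `2L+2` leaves `L` unchanged, so the recursion here is on the tail; the other cases
  -- lower `L`.
  ... | yes refl | _ = ∈-++⁺ʳ (𝒫od≤ L n ++ map (a ∷_) (lag a (𝒫od≤ L) [] n))
        (∈-map-lag (suc a) (sum xs) (subst (xs ∈_) (sym (𝒫od≤-suc L (sum xs))) (go xs (uncons v))))
  ... | no _ | yes refl = ∈-++⁺ˡ (∈-++⁺ʳ (𝒫od≤ L n)
        (∈-map-lag a (sum xs) (𝒫od≤-complete L xs (uncons-odd (odd-double L) v))))
  ... | no x≢b | no x≢a = ∈-++⁺ˡ (∈-++⁺ˡ (𝒫od≤-complete L (x ∷ xs) record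
        { partition = partition v ; oddOnce = oddOnce v
        ; parts≤ = x≤2L ∷ All.map (λ y≤x → ℕ.≤-trans y≤x x≤2L) (parts≤ (uncons v)) }))
    where
    x≤2L : x ≤ double L
    x≤2L = ℕ.≤-pred (ℕ.≤∧≢⇒< (ℕ.≤-pred (ℕ.≤∧≢⇒< x≤ x≢b)) x≢a)

disjoint-map-∷ : ∀ {M x xss yss} → All (All (_≤ M)) xss → M < x → Disjoint xss (map (x ∷_) yss)
disjoint-map-∷ xss≤M M<x (i , j) with ∈-map⁻ _ j
... | ys , _ , refl with All.lookup xss≤M i
... | x≤M ∷ _ = ℕ.<⇒≱ M<x x≤M

-- The three pieces of `extend` are told apart by their largest parts: at most `2L`, equal to
-- `2L+1`, equal to `2L+2`.
𝒫od≤-unique : ∀ L n → Unique (𝒫od≤ L n)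
𝒫od≤-unique zero    zero    = [] AllPairs.∷ AllPairs.[]
𝒫od≤-unique zero    (suc n) = AllPairs.[]
𝒫od≤-unique (suc L) = <-rec _ λ n ih → subst Unique (sym (𝒫od≤-suc L n))
  (Unique.++⁺
    (Unique.++⁺ (𝒫od≤-unique L n)
      (Unique.map⁺ ∷-injectiveʳ (lag-elim-< Unique (double L) n AllPairs.[] λ {m} _ → 𝒫od≤-unique L m))
      (disjoint-map-∷ (All.map parts≤ (𝒫od≤-sound L n)) ℕ.≤-refl))
    (Unique.map⁺ ∷-injectiveʳ (lag-elim-< Unique a n AllPairs.[] ih))
    (disjoint-map-∷ (All.++⁺
      (All.map (λ v → All.map ℕ.m≤n⇒m≤1+n (parts≤ v)) (𝒫od≤-sound L n))
      (map-lag-All {P = λ _ xs → All (_≤ double L) xs} {Q = λ _ xs → All (_≤ a) xs} a (s≤s z≤n)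
        (λ _ xs≤ → ℕ.≤-refl ∷ All.map ℕ.m≤n⇒m≤1+n xs≤) n λ {m} _ → All.map parts≤ (𝒫od≤-sound L m)))
      ℕ.≤-refl))
  where a = suc (double L)

-- Comparison with `𝒫od`

∈⇒≤sum : ∀ {x xs} → x ∈ xs → x ≤ sum xs
∈⇒≤sum {xs = y ∷ ys} (here refl) = ℕ.m≤m+n y (sum ys)
∈⇒≤sum {xs = y ∷ ys} (there i)   = ℕ.≤-trans (∈⇒≤sum i) (ℕ.m≤n+m (sum ys) y)

∈𝒫od⇒bounded : ∀ {M n xs} → n ≤ M → xs ∈𝒫od n → Bounded𝒫od M n xs
∈𝒫od⇒bounded {xs = xs} n≤M (part@(_ , _ , refl) , distinct) = record
  { partition = part
  ; oddOnce   = once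
  ; parts≤    = All.tabulate λ x∈ → ℕ.≤-trans (∈⇒≤sum x∈) n≤M }
  where
  once : ∀ p → Odd p → multiplicity p xs ≤ 1
  once p o with multiplicity p xs ℕ.≤? 1
  ... | yes m≤1 = m≤1
  ... | no  m≰1 = ⊥-elim (m≰1 (subst (_≤ 1) (sym (multiplicity-∉ xs p∉)) z≤n))
    where
    p∉ : p ∉ xs
    p∉ p∈ = m≰1 (All.lookup distinct p∈ o)

-- Two duplicate-free lists with the same members are permutations of each other; `n ≤ 2L` makes the
-- bound on the parts automatic.
σodmoex-𝒫od≤ : ∀ L n → n ≤ double L → σodmoex n ≡ sum (map moex (𝒫od≤ L n))
σodmoex-𝒫od≤ L n n≤2L = sum-↭ (Permutation.map⁺ moex (∼bag⇒↭
  (unique∧set⇒bag (𝒫od-unique n) (𝒫od≤-unique L n) λ {xs} → mk⇔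
    (λ i → 𝒫od≤-complete L xs (∈𝒫od⇒bounded n≤2L (Equivalence.to (∈-𝒫od⇔ n xs) i)))
    (λ i → let v = All.lookup (𝒫od≤-sound L n) i in
           Equivalence.from (∈-𝒫od⇔ n xs) (partition v , All.tabulate λ {p} _ → oddOnce v p)))))

-- The recurrence for the sum of moex

isMoex-unique : ∀ {xs m m′} → IsMoex xs m → IsMoex xs m′ → m ≡ m′
isMoex-unique ((o , m∉) , least) ((o′ , m′∉) , least′) =
  ℕ.≤-antisym (least _ o′ m′∉) (least′ _ o m∉)

moex-≡ : ∀ {xs m} → IsMoex xs m → moex xs ≡ m
moex-≡ {xs} = isMoex-unique (moex-isMoex xs)

moex-∷-≢ : ∀ x xs → moex xs ≢ x → moex (x ∷ xs) ≡ moex xs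
moex-∷-≢ x xs m≢x with moex-isMoex xs
... | (o , m∉) , least = moex-≡ ((o , λ { (here m≡x) → m≢x m≡x ; (there i) → m∉ i })
                                , λ k ok k∉ → least k ok (k∉ ∘ there))

moex-∷-even : ∀ x xs → ¬ Odd x → moex (x ∷ xs) ≡ moex xs
moex-∷-even x xs ¬o = moex-∷-≢ x xs λ m≡x → ¬o (subst Odd m≡x (proj₁ (proj₁ (moex-isMoex xs))))

moex-∷-≡ : ∀ {x xs} → All (_≤ x) xs → moex xs ≡ x → moex (x ∷ xs) ≡ 2 + x
moex-∷-≡ {x} {xs} xs≤x refl with moex-isMoex xs
... | (o , m∉) , least = moex-≡ ((o , <⇒∉ (ℕ.≤-refl ∷ xs≤x) (ℕ.m<n+m x (s≤s z≤n))) , least′)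
  where
  least′ : ∀ k → Odd k → k ∉ x ∷ xs → 2 + x ≤ k
  least′ k ok k∉ = ℕ.≤∧≢⇒< (ℕ.≤∧≢⇒< (least k ok (k∉ ∘ there)) (λ { refl → k∉ (here refl) }))
                             (λ { refl → ¬odd-suc x o ok })

moex≤ : ∀ {L xs} → All (_≤ double L) xs → moex xs ≤ suc (double L)
moex≤ {L} {xs} xs≤ = proj₂ (moex-isMoex xs) _ (odd-double L) (<⇒∉ xs≤ ℕ.≤-refl)

[_≡?_] : ℕ → ℕ → ℕ
[ m ≡? k ] = if does (m ≟ k) then 1 else 0

[≡]-yes : ∀ {m k} → m ≡ k → [ m ≡? k ] ≡ 1
[≡]-yes {m} {k} m≡k = cong (λ t → if t then 1 else 0) (dec-true (m ≟ k) m≡k)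

[≡]-no : ∀ {m k} → m ≢ k → [ m ≡? k ] ≡ 0
[≡]-no {m} {k} m≢k = cong (λ t → if t then 1 else 0) (dec-false (m ≟ k) m≢k)

-- For parts at most `2L` this indicates the largest possible moex, that is, that 1, 3, ..., `2L-1`
-- all occur. Their sum `L²` is the exponent in `F_L`.
isFull : ℕ → List ℕ → ℕ
isFull L xs = [ moex xs ≡? suc (double L) ]

isFull-below : ∀ L xs → All (_≤ double L) xs → isFull (suc L) xs ≡ 0
isFull-below L xs xs≤ = [≡]-no (ℕ.<⇒≢ (ℕ.≤-<-trans (moex≤ {L} xs≤) (ℕ.m<n+m (suc (double L)) {2} (s≤s z≤n))))

moex-∷-odd : ∀ L xs → All (_≤ double L) xs →
  moex (suc (double L) ∷ xs) ≡ moex xs + 2 * isFull L xs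
moex-∷-odd L xs xs≤ with moex xs ≟ suc (double L)
... | yes eq = trans (moex-∷-≡ (All.map ℕ.m≤n⇒m≤1+n xs≤) eq)
  (trans (ℕ.+-comm 2 (suc (double L))) (cong₂ (λ m i → m + 2 * i) (sym eq) (sym ([≡]-yes eq))))
... | no neq = trans (moex-∷-≢ _ xs neq)
  (trans (sym (ℕ.+-identityʳ _)) (cong (λ i → moex xs + 2 * i) (sym ([≡]-no neq))))

isFull-∷-odd : ∀ L xs → All (_≤ double L) xs → isFull (suc L) (suc (double L) ∷ xs) ≡ isFull L xs
isFull-∷-odd L xs xs≤ with moex xs ≟ suc (double L)
... | yes eq = trans ([≡]-yes (moex-∷-≡ (All.map ℕ.m≤n⇒m≤1+n xs≤) eq)) (sym ([≡]-yes eq))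
... | no neq = trans (cong [_≡? suc (double (suc L)) ] (moex-∷-≢ _ xs neq))
  (trans (isFull-below L xs xs≤) (sym ([≡]-no neq)))

total : (List ℕ → ℕ) → List (List ℕ) → ℤ
total w xss = + sum (map w xss)

total-++ : ∀ w xss yss → total w (xss ++ yss) ≡ total w xss ℤ.+ total w yss
total-++ w xss yss = cong +_ (trans (cong sum (map-++ w xss yss)) (sum-++ (map w xss) (map w yss)))

total-map-∷ : ∀ w x xss → total w (map (x ∷_) xss) ≡ total (w ∘ (x ∷_)) xss
total-map-∷ w x xss = cong (+_ ∘ sum) (sym (map-∘ xss))

weight : (List ℕ → ℕ) → ℕ → Series
weight w L n = total w (𝒫od≤ L n)

-- The weight is arbitrary so that one recurrence serves both `moex` and `isFull`; prepending a part
-- becomes composition with the weight.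
weight-suc : ∀ w L n → weight w (suc L) n ≡
  (weight w L n ℤ.+ shift (suc (double L)) (weight (w ∘ (suc (double L) ∷_)) L) n)
  ℤ.+ shift (double (suc L)) (weight (w ∘ (double (suc L) ∷_)) (suc L)) n
weight-suc w L n = begin
  weight w (suc L) n
    ≡⟨ cong (total w) (𝒫od≤-suc L n) ⟩
  total w (extend L (𝒫od≤ L) n (lag (suc a) (𝒫od≤ (suc L)) [] n))
    ≡⟨ total-++ w (𝒫od≤ L n ++ map (a ∷_) (lag a (𝒫od≤ L) [] n)) _ ⟩
  total w (𝒫od≤ L n ++ map (a ∷_) (lag a (𝒫od≤ L) [] n))
  ℤ.+ total w (map (suc a ∷_) (lag (suc a) (𝒫od≤ (suc L)) [] n))
    ≡⟨ cong (ℤ._+ total w (map (suc a ∷_) (lag (suc a) (𝒫od≤ (suc L)) [] n)))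
            (total-++ w (𝒫od≤ L n) (map (a ∷_) (lag a (𝒫od≤ L) [] n))) ⟩
  (weight w L n ℤ.+ total w (map (a ∷_) (lag a (𝒫od≤ L) [] n)))
  ℤ.+ total w (map (suc a ∷_) (lag (suc a) (𝒫od≤ (suc L)) [] n))
    ≡⟨ cong₂ ℤ._+_ (cong (λ x → weight w L n ℤ.+ x) (lagged a (𝒫od≤ L))) (lagged (suc a) (𝒫od≤ (suc L))) ⟩
  (weight w L n ℤ.+ shift a (weight (w ∘ (a ∷_)) L) n)
  ℤ.+ shift (suc a) (weight (w ∘ (suc a ∷_)) (suc L)) n ∎
  where
  open ≡-Reasoning
  a = suc (double L)
  lagged : ∀ x f → total w (map (x ∷_) (lag x f [] n)) ≡ shift x (λ m → total (w ∘ (x ∷_)) (f m)) n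
  lagged x f = trans (total-map-∷ w x (lag x f [] n)) (lag-natural (total (w ∘ (x ∷_))) x f [] n)

weight-cong : ∀ L {w w′} → (∀ xs → All (_≤ double L) xs → w xs ≡ w′ xs) → ∀ n → weight w L n ≡ weight w′ L n
weight-cong L eq n = cong (+_ ∘ sum) (map-cong-local (All.map (λ {xs} v → eq xs (parts≤ v)) (𝒫od≤-sound L n)))

weight-zero : ∀ L n → weight (λ _ → 0) L n ≡ 0ℤ
weight-zero L n = cong +_ (zeros (𝒫od≤ L n))
  where
  zeros : ∀ (xss : List (List ℕ)) → sum (map (λ _ → 0) xss) ≡ 0
  zeros []         = refl
  zeros (_ ∷ xss)  = zeros xss

weight-linear : ∀ v w L n → weight (λ xs → v xs + 2 * w xs) L n ≡ weight v L n ℤ.+ + 2 ℤ.* weight w L n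
weight-linear v w L n = linear (𝒫od≤ L n)
  where
  regroup : ∀ p q r s → (p ℤ.+ + 2 ℤ.* q) ℤ.+ (r ℤ.+ + 2 ℤ.* s) ≡ (p ℤ.+ r) ℤ.+ + 2 ℤ.* (q ℤ.+ s)
  regroup = solve-∀
  linear : ∀ xss → total (λ xs → v xs + 2 * w xs) xss ≡ total v xss ℤ.+ + 2 ℤ.* total w xss
  linear []         = refl
  linear (xs ∷ xss) = trans
    (cong₂ ℤ._+_ (cong (λ x → + v xs ℤ.+ x) (ℤ.pos-* 2 (w xs))) (linear xss))
    (regroup (+ v xs) (+ w xs) (total v xss) (total w xss))

-- At level `L+1` the part `2L+1` must occur, removing it leaves a full partition of level `L`, and
-- copies of `2L+2` change nothing. This is the recurrence of `full`.
weight-isFull : ∀ L n → weight (isFull L) L n ≡ full L n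
weight-isFull zero    zero    = refl
weight-isFull zero    (suc n) = refl
weight-isFull (suc L) = geometric-unique (suc (double L)) (shift a (full L)) eq (geometric-eq (suc (double L)) (shift a (full L)))
  where
  a = suc (double L)
  eq : ∀ n → weight (isFull (suc L)) (suc L) n ≡
    shift a (full L) n ℤ.+ shift (suc a) (weight (isFull (suc L)) (suc L)) n
  eq n = trans (weight-suc (isFull (suc L)) L n) (cong₂ ℤ._+_
    (trans (cong₂ ℤ._+_ (trans (weight-cong L (isFull-below L) n) (weight-zero L n))
        (shift-cong a (λ m → trans (weight-cong L (isFull-∷-odd L) m) (weight-isFull L m)) n))
      (ℤ.+-identityˡ (shift a (full L) n)))
    (shift-cong (suc a) (weight-cong (suc L) λ xs _ →
      cong [_≡? suc (double (suc L)) ] (moex-∷-even (suc a) xs (¬odd-double (suc L)))) n))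

moexSum : ℕ → Series
moexSum = weight moex

moexSum-suc : ∀ L n → let a = suc (double L) in moexSum (suc L) n ≡
  ((moexSum L n ℤ.+ shift a (moexSum L) n) ℤ.+ + 2 ℤ.* shift a (full L) n)
  ℤ.+ shift (suc a) (moexSum (suc L)) n
moexSum-suc L n = trans (weight-suc moex L n) (cong₂ ℤ._+_
  (trans (cong (λ x → moexSum L n ℤ.+ x) odd) (sym (ℤ.+-assoc (moexSum L n) (shift a (moexSum L) n) (+ 2 ℤ.* shift a (full L) n))))
  (shift-cong (suc a) (weight-cong (suc L) λ xs _ → moex-∷-even (suc a) xs (¬odd-double (suc L))) n))
  where
  a = suc (double L)
  odd : shift a (weight (moex ∘ (a ∷_)) L) n ≡ shift a (moexSum L) n ℤ.+ + 2 ℤ.* shift a (full L) n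
  odd = trans (shift-cong a (λ m → trans (weight-cong L (moex-∷-odd L) m)
                (trans (weight-linear moex (isFull L) L m)
                       (cong (λ x → moexSum L m ℤ.+ + 2 ℤ.* x) (weight-isFull L m)))) n)
        (trans (shift-+ a (moexSum L) (λ m → + 2 ℤ.* full L m) n)
               (cong (λ x → shift a (moexSum L) n ℤ.+ x) (shift-* a (+ 2) (full L) n)))

-- The first difference of the sum of moex

Δ : Series → Series
Δ f n = f n ℤ.- shift 1 f n

-- The relation `(1 - q^(2L)) F_L = q^(2L-1) F_{L-1}` times `q`, which avoids the exponent -1 at
-- `L = 0`.
shift-1-full : ∀ L n → shift 1 (full L) n ≡
  shift (double L) (fullPred L) n ℤ.+ shift (suc (double L)) (full L) n
shift-1-full zero    n       = sym (ℤ.+-identityˡ _)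
shift-1-full (suc L) zero    = refl
shift-1-full (suc L) (suc n) = geometric-eq (suc (double L)) (shift (suc (double L)) (full L)) n

shift-Δ : ∀ k f n → shift k (Δ f) n ≡ Δ (shift k f) n
shift-Δ k f n = trans (shift-- k f (shift 1 f) n) (cong (λ x → shift k f n ℤ.- x) (shift-comm k 1 f n))

Δ-cong : ∀ {f g : Series} → (∀ n → f n ≡ g n) → ∀ n → Δ f n ≡ Δ g n
Δ-cong eq n = cong₂ ℤ._-_ (eq n) (shift-cong 1 eq n)

Δ-+ : ∀ f g n → Δ (λ m → f m ℤ.+ g m) n ≡ Δ f n ℤ.+ Δ g n
Δ-+ f g n = trans (cong (λ x → (f n ℤ.+ g n) ℤ.- x) (shift-+ 1 f g n))
                  (regroup (f n) (g n) (shift 1 f n) (shift 1 g n))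
  where
  regroup : ∀ x y z w → (x ℤ.+ y) ℤ.- (z ℤ.+ w) ≡ (x ℤ.- z) ℤ.+ (y ℤ.- w)
  regroup = solve-∀

Δ-* : ∀ c f n → Δ (λ m → c ℤ.* f m) n ≡ c ℤ.* Δ f n
Δ-* c f n = trans (cong (λ x → c ℤ.* f n ℤ.- x) (shift-* 1 c f n)) (factor c (f n) (shift 1 f n))
  where
  factor : ∀ c x y → c ℤ.* x ℤ.- c ℤ.* y ≡ c ℤ.* (x ℤ.- y)
  factor = solve-∀

Δ-shift : ∀ k f n → Δ (shift k f) n ≡ shift k f n ℤ.- shift (suc k) f n
Δ-shift k f n = cong (λ x → shift k f n ℤ.- x) (shift-shift 1 k f n)

decomposition : ℕ → Series
decomposition L n = excess L n ℤ.+ + 2 ℤ.* (fullPred L n ℤ.+ Δ (full L) n)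

-- Induction on `L`: both sides at level `L+1` have the same product `φ` with `1 - q^b`. On the left
-- it comes from the recurrence of `moexSum` and the induction hypothesis, on the right from those
-- of `excess` and `full`.
Δ-moexSum : ∀ L n → Δ (moexSum L) n ≡ decomposition L n
Δ-moexSum zero n = trans (Δ-cong moexSum-0 n) (rearrange (δ n) (shift 1 δ n))
  where
  moexSum-0 : ∀ n → moexSum 0 n ≡ δ n
  moexSum-0 zero    = refl
  moexSum-0 (suc n) = refl
  rearrange : ∀ x y → x ℤ.- y ≡ (y ℤ.- x) ℤ.+ + 2 ℤ.* (0ℤ ℤ.+ (x ℤ.- y))
  rearrange = solve-∀
Δ-moexSum (suc L) = geometric-unique (suc (double L)) φ left right
  where
  a = suc (double L)
  b = suc a
  c = double L
  A = moexSum L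
  F = full L
  P = fullPred L

  φ : Series
  φ n = (decomposition L n ℤ.+ shift a (decomposition L) n) ℤ.+ + 2 ℤ.* Δ (shift a F) n

  left : ∀ n → Δ (moexSum (suc L)) n ≡ φ n ℤ.+ shift b (Δ (moexSum (suc L))) n
  left n = begin
    Δ (moexSum (suc L)) n
      ≡⟨ Δ-cong (moexSum-suc L) n ⟩
    Δ (λ m → ((A m ℤ.+ shift a A m) ℤ.+ + 2 ℤ.* shift a F m) ℤ.+ shift b (moexSum (suc L)) m) n
      ≡⟨ Δ-+ (λ m → (A m ℤ.+ shift a A m) ℤ.+ + 2 ℤ.* shift a F m) (shift b (moexSum (suc L))) n ⟩
    Δ (λ m → (A m ℤ.+ shift a A m) ℤ.+ + 2 ℤ.* shift a F m) n ℤ.+ Δ (shift b (moexSum (suc L))) n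
      ≡⟨ cong₂ ℤ._+_ numerator (sym (shift-Δ b (moexSum (suc L)) n)) ⟩
    φ n ℤ.+ shift b (Δ (moexSum (suc L))) n ∎
    where
    open ≡-Reasoning
    numerator : Δ (λ m → (A m ℤ.+ shift a A m) ℤ.+ + 2 ℤ.* shift a F m) n ≡ φ n
    numerator = trans (Δ-+ (λ m → A m ℤ.+ shift a A m) (λ m → + 2 ℤ.* shift a F m) n)
      (cong₂ ℤ._+_
        (trans (Δ-+ A (shift a A) n) (cong₂ ℤ._+_ (Δ-moexSum L n)
          (trans (sym (shift-Δ a A n)) (shift-cong a (Δ-moexSum L) n))))
        (Δ-* (+ 2) (shift a F) n))

  shift-decomposition : ∀ k M n → shift k (decomposition M) n ≡
    shift k (excess M) n ℤ.+ + 2 ℤ.* (shift k (fullPred M) n ℤ.+ Δ (shift k (full M)) n)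
  shift-decomposition k M n = trans (shift-+ k (excess M) (λ m → + 2 ℤ.* (fullPred M m ℤ.+ Δ (full M) m)) n)
    (cong (λ x → shift k (excess M) n ℤ.+ x)
      (trans (shift-* k (+ 2) (λ m → fullPred M m ℤ.+ Δ (full M) m) n)
        (cong (λ x → + 2 ℤ.* x) (trans (shift-+ k (fullPred M) (Δ (full M)) n)
          (cong (λ x → shift k (fullPred M) n ℤ.+ x) (shift-Δ k (full M) n))))))

  -- With P = F_{L-1}, F = F_L, X⁺ = X_{L+1}, F⁺ = F_{L+1}, and aX for a coefficient of q^a X, this is
  -- X⁺ + 2 (F + Δ F⁺) = φ + q^b (X⁺ + 2 (F + Δ F⁺)) after expanding X⁺ and F⁺.
  identity : ∀ X aX P aP cP F aF bF bX⁺ bΔF⁺ →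
    ((X ℤ.+ aX) ℤ.+ + 2 ℤ.* ((P ℤ.- cP) ℤ.+ aP) ℤ.+ bX⁺) ℤ.+ + 2 ℤ.* (F ℤ.+ ((aF ℤ.- bF) ℤ.+ bΔF⁺))
    ≡ (((X ℤ.+ + 2 ℤ.* (P ℤ.+ (F ℤ.- (cP ℤ.+ aF)))) ℤ.+ (aX ℤ.+ + 2 ℤ.* (aP ℤ.+ (aF ℤ.- bF))))
      ℤ.+ + 2 ℤ.* (aF ℤ.- bF)) ℤ.+ (bX⁺ ℤ.+ + 2 ℤ.* (bF ℤ.+ bΔF⁺))
  identity = solve-∀

  right : ∀ n → decomposition (suc L) n ≡ φ n ℤ.+ shift b (decomposition (suc L)) n
  right n = begin
    decomposition (suc L) n
      ≡⟨ cong₂ (λ x y → x ℤ.+ + 2 ℤ.* (F n ℤ.+ y))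
           (geometric-eq a (excessNumerator L (excess L)) n)
           (trans (Δ-cong (geometric-eq a (shift a F)) n)
             (trans (Δ-+ (shift a F) (shift b (full (suc L))) n)
               (cong (λ x → x ℤ.+ Δ (shift b (full (suc L))) n) (Δ-shift a F n)))) ⟩
    _ ≡⟨ identity (excess L n) (shift a (excess L) n) (P n) (shift a P n) (shift c P n)
           (F n) (shift a F n) (shift b F n) (shift b (excess (suc L)) n) (Δ (shift b (full (suc L))) n) ⟩
    _ ≡⟨ cong₂ ℤ._+_
           (cong₂ ℤ._+_
             (cong₂ ℤ._+_
               -- The relation between `F_L` and `F_{L-1}` enters here, turning
               -- `q^(2L) F_{L-1} + q^a F_L` into `q F_L`.
               (cong (λ x → excess L n ℤ.+ + 2 ℤ.* (P n ℤ.+ (F n ℤ.- x))) (sym (shift-1-full L n)))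
               (trans (cong (λ x → shift a (excess L) n ℤ.+ + 2 ℤ.* (shift a P n ℤ.+ x)) (sym (Δ-shift a F n)))
                      (sym (shift-decomposition a L n))))
             (cong (λ x → + 2 ℤ.* x) (sym (Δ-shift a F n))))
           (sym (shift-decomposition b (suc L) n)) ⟩
    φ n ℤ.+ shift b (decomposition (suc L)) n ∎
    where open ≡-Reasoning

theorem1p6 : (n : ℕ) → n ≥ 4 → σodmoex (n + 1) > σodmoex n
theorem1p6 _ (s≤s (s≤s (s≤s (s≤s {n = n} z≤n)))) = ℤ.drop‿+<+
  (subst₂ (λ x y → + x ℤ.< + y)
    (sym (σodmoex-𝒫od≤ L (4 + n) (ℕ.≤-trans (ℕ.m≤n+m (4 + n) 2) (n≤double L))))
    (sym (trans (cong σodmoex (ℕ.+-comm (4 + n) 1))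
                (σodmoex-𝒫od≤ L (5 + n) (ℕ.≤-trans (ℕ.n≤1+n (5 + n)) (n≤double L)))))
    (ℤ.suc[i]≤j⇒i<j (subst₂ ℤ._≤_ refl (cancel (moexSum L (4 + n)) (moexSum L (5 + n)))
      (ℤ.+-monoˡ-≤ (moexSum L (4 + n)) one≤Δ))))
  where
  -- `L` exceeds the position `5 + n` of the difference, so `F_L` vanishes there and at `4 + n`, and
  -- `2L` bounds all parts that occur.
  L = 6 + n
  cancel : ∀ x y → (y ℤ.- x) ℤ.+ x ≡ y
  cancel = solve-∀
  Δfull : Δ (full L) (5 + n) ≡ 0ℤ
  Δfull = cong₂ ℤ._-_ (full-zero-below L (5 + n) ℕ.≤-refl) (full-zero-below L (4 + n) (ℕ.n≤1+n (5 + n)))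
  one≤Δ : 1ℤ ℤ.≤ Δ (moexSum L) (5 + n)
  one≤Δ = subst (1ℤ ℤ.≤_) (sym (Δ-moexSum L (5 + n))) (ℤ.+-mono-≤ (one≤excess (2 + n) n)
    (ℤ.*-monoˡ-≤-nonNeg (+ 2) {0ℤ} (ℤ.+-mono-≤ (full-nonNegative (5 + n) (5 + n)) (ℤ.≤-reflexive (sym Δfull)))))
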